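{- Let $q$ be a power of a prime $p$, let $0\le j\le q-2$ and $n\ge1$ be integers, and put $k=2j+2+(n-1)(q-1)$ and $m\equiv j+1\pmod{q-1}$. The smallest possible slope for the Atkin operator $\mathbf{U}_t$ acting on $S^1_{k,m}(\Gamma_0(t))$ is $j+1$ (i.e. every slope $\alpha$ satisfies $\alpha\ge j+1$), and moreover its multiplicity satisfies $$d(j+1,k)\le1.$$
   Context: $K_\infty$ is the completion of $\mathbb{F}_q(t)$ at $\infty=1/t$, $\mathbb{C}_\infty$ is the completion of an algebraic closure of $K_\infty$, $\Omega=\mathbb{P}^1(\mathbb{C}_\infty)-\mathbb{P}^1(K_\infty)$. $\Gamma_0(t)=\{\begin{pmatrix}a&b\\c&d\end{pmatrix}\in GL_2(\mathbb{F}_q[t]):c\equiv0\bmod t\}$. $S^1_{k,m}(\Gamma_0(t))$ is the space of Drinfeld cusp forms of weight $k$ and type $m$: rigid analytic $\varphi:\Omega\to\mathbb{C}_\infty$ with $\varphi(\gamma z)(\det\gamma)^m(cz+d)^{ -k}=\varphi(z)$ for all $\gamma=\begin{pmatrix}a&b\\c&d\end{pmatrix}\in\Gamma_0(t)$, holomorphic and vanishing at all cusps. $\mathbf{U}_t(\varphi)(z)=\sum_{b\in\mathbb{F}_q}\varphi\left(\frac{z+b}{t}\right)$. For $k,j,n,m$ as in the claim, $S^1_{k,m}(\Gamma_0(t))$ has dimension $n$ and in a suitable basis (of harmonic cocycles) $\mathbf{U}_t$ has matrix $MD$, where $M=(m_{a,b})_{1\le a,b\le n}$ has entries in $\mathbb{F}_p$,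 $m_{a,b}=-\left[\binom{j+(n-a)(q-1)}{j+(n-b)(q-1)}+(-1)^{j+1}\binom{j+(n-a)(q-1)}{j+(b-1)(q-1)}\right]$ if $a\ne b$, $m_{a,a}=(-1)^j\binom{j+(n-a)(q-1)}{j+(a-1)(q-1)}$ (with $\binom{x}{y}=0$ if $y>x$), and $D=\mathrm{diag}(t^{s_1},\dots,t^{s_n})$ with $s_i=j+1+(i-1)(q-1)$. Slopes: the characteristic polynomial $P_{\mathbf{U}_t}(X)$ of $\mathbf{U}_t$ on $S^1_{k,m}(\Gamma_0(t))$ has coefficients in $\mathbb{F}_q[t]$; let $v_t$ be the $t$-adic valuation ($v_t(t)=1$), extended to an algebraic closure of $\mathbb{F}_q((t))$. For $\alpha\in\mathbb{Q}$, $d(\alpha,k)$ is the number of roots of $P_{\mathbf{U}_t}(X)$, counted with multiplicity, of $t$-adic valuation $\alpha$; $\alpha$ is a slope (of multiplicity $d(\alpha,k)$) if $d(\alpha,k)\ge1$. The root $0$ does not contribute a slope. -}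

module Defs where

open import Algebra.Bundles using (CommutativeRing; RawRing)
open import Algebra.Core using (Op₁; Op₂)
import Algebra.Definitions.RawSemiring as RawSemiringDefs
open import Algebra.Morphism.Structures using (IsRingHomomorphism)
open import Data.Bool.Base using (if_then_else_)
open import Data.Fin.Base using (Fin; zero; suc; toℕ; punchIn)
import Data.Fin.Properties as Fin
open import Data.Integer.Base as ℤ using (ℤ; +_; -[1+_])
open import Data.List.Base as List using (List; []; _∷_; _++_)
open import Data.Maybe.Base using (zipWith)
open import Data.Nat.Base as ℕ using (ℕ; zero; suc; _∸_)
open import Data.Nat.Combinatorics using (_C_)
open import Data.Product.Base using (Σ-syntax; ∃-syntax; _×_; proj₁)
open import Data.Rational.Base as ℚ using (ℚ; 0ℚ; 1ℚ)
import Data.Rational.Properties as ℚ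
open import Data.Vec.Base as Vec using (Vec)
open import Function.Bundles using (Inverse)
open import Level using (Level; _⊔_) renaming (suc to lsuc)
open import Relation.Binary.Construct.Add.Supremum.NonStrict ℚ._≤_ public using (_≤⁺_)
open import Relation.Binary.PropositionalEquality.Core using (_≡_)
import Relation.Binary.PropositionalEquality.Properties as ≡
open import Relation.Nullary.Construct.Add.Supremum using (_⁺; ⊤⁺; [_]; ≡-dec)
open import Relation.Nullary.Decidable.Core using (does)
open import Relation.Nullary.Negation.Core using (¬_)

private
  variable
    c ℓ : Level

------------------------------------------------------------------------
-- Polynomials and determinants

-- A list a₀ ∷ a₁ ∷ … stands for a₀ + a₁ X + …; trailing zeros are
-- immaterial because _≈_ compares coefficients.
module Polynomial (R : RawRing c ℓ) where
  open RawRing R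

  coeff : List Carrier → ℕ → Carrier
  coeff []      i       = 0#
  coeff (a ∷ p) zero    = a
  coeff (a ∷ p) (suc i) = coeff p i

  addᴾ : Op₂ (List Carrier)
  addᴾ []      r       = r
  addᴾ (a ∷ p) []      = a ∷ p
  addᴾ (a ∷ p) (b ∷ r) = a + b ∷ addᴾ p r

  mulᴾ : Op₂ (List Carrier)
  mulᴾ []      r = []
  mulᴾ (a ∷ p) r = addᴾ (List.map (a *_) r) (0# ∷ mulᴾ p r)

  const : Carrier → List Carrier
  const a = a ∷ []

  indeterminate : List Carrier
  indeterminate = 0# ∷ 1# ∷ []

  polynomialRing : RawRing c ℓ
  polynomialRing = record
    { Carrier = List Carrier
    ; _≈_     = λ p r → ∀ i → coeff p i ≈ coeff r i
    ; _+_     = addᴾ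
    ; _*_     = mulᴾ
    ; -_      = List.map (-_)
    ; 0#      = []
    ; 1#      = const 1#
    }

  -- X ^ n + aₙ₋₁ X ^ (n ∸ 1) + … + a₀
  monic : ∀ {n} → Vec Carrier n → List Carrier
  monic a = Vec.toList a ++ (1# ∷ [])

  ∏[X-_] : ∀ {n} → Vec Carrier n → List Carrier
  ∏[X- Vec.[] ]     = const 1#
  ∏[X- r Vec.∷ rs ] = mulᴾ (- r ∷ 1# ∷ []) ∏[X- rs ]

Matrix : Set c → ℕ → Set c
Matrix A n = Fin n → Fin n → A

module Determinant (R : RawRing c ℓ) where
  open RawRing R
  open RawSemiringDefs rawSemiring using (sum; _^_)

  -- Laplace expansion along the first row
  det : ∀ {n} → Matrix Carrier n → Carrier
  det {zero}  A = 1#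
  det {suc n} A = sum λ j →
    (- 1#) ^ toℕ j * (A zero j * det λ a b → A (suc a) (punchIn j b))

module _ (R : RawRing c ℓ) where
  open Polynomial R
  open RawRing polynomialRing
  open Determinant polynomialRing using (det)

  charPoly : ∀ {n} → Matrix (RawRing.Carrier R) n → Carrier
  charPoly A = det λ a b →
    (if does (a Fin.≟ b) then indeterminate else 0#) + - const (A a b)

------------------------------------------------------------------------
-- Fields and valuations

-- x ⁻¹ is only meaningful for x ≉ 0#.  The library's Heyting fields carry
-- an apartness relation; here every field but 𝔽_q has a valuation with
-- values in ℚ ⁺, so that equality with 0# is decidable and the classical
-- formulation is adequate.
record Field (c ℓ : Level) : Set (lsuc (c ⊔ ℓ)) where
  field
    commutativeRing : CommutativeRing c ℓ

  open CommutativeRing commutativeRing public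

  infix 9 _⁻¹
  field
    1≉0     : ¬ 1# ≈ 0#
    _⁻¹     : Op₁ Carrier
    ⁻¹-cong : ∀ {x y} → x ≈ y → x ⁻¹ ≈ y ⁻¹
    *-⁻¹    : ∀ x → ¬ x ≈ 0# → x * x ⁻¹ ≈ 1#

  open RawSemiringDefs (RawRing.rawSemiring rawRing) public using (sum; _^_) renaming (_×_ to _·_)
  open Polynomial rawRing public

  infixr 8 _^ℤ_
  _^ℤ_ : Carrier → ℤ → Carrier
  x ^ℤ (+ n)    = x ^ n
  x ^ℤ -[1+ n ] = (x ⁻¹) ^ suc n

record FieldHom (K L : Field c ℓ) : Set (c ⊔ ℓ) where
  private
    module K = Field K
    module L = Field L
  field
    ⟦_⟧            : K.Carrier → L.Carrier
    isHomomorphism : IsRingHomomorphism K.rawRing L.rawRing ⟦_⟧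

  evalAt : L.Carrier → List K.Carrier → L.Carrier
  evalAt x = List.foldr (λ a y → ⟦ a ⟧ L.+ x L.* y) L.0#

infixl 6 _+⁺_
_+⁺_ : Op₂ (ℚ ⁺)
_+⁺_ = zipWith ℚ._+_

-- All the valued fields that occur (C_∞ included) have value group
-- contained in ℚ.  A valuation v is written additively: |x| = q ^ (- v x).
record ValuedField (c ℓ : Level) : Set (lsuc (c ⊔ ℓ)) where
  field
    field′ : Field c ℓ

  open Field field′ public

  field
    v             : Carrier → ℚ ⁺
    v-cong        : ∀ {x y} → x ≈ y → v x ≡ v y
    v-*           : ∀ x y → v (x * y) ≡ v x +⁺ v y
    v-ultrametric : ∀ x y → v x ≤⁺ v y → v x ≤⁺ v (x + y)
    v-0           : v 0# ≡ ⊤⁺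
    v-⊤           : ∀ x → v x ≡ ⊤⁺ → x ≈ 0#

  infix 4 _⟶_
  _⟶_ : (ℕ → Carrier) → Carrier → Set
  x ⟶ l = ∀ (B : ℚ) → ∃[ N ] ∀ n → N ℕ.≤ n → [ B ] ≤⁺ v (x n - l)

  Cauchy : (ℕ → Carrier) → Set
  Cauchy x = ∀ (B : ℚ) → ∃[ N ] ∀ n n′ → N ℕ.≤ n → N ℕ.≤ n′ → [ B ] ≤⁺ v (x n - x n′)

  evalSelf : Carrier → List Carrier → Carrier
  evalSelf x = List.foldr (λ a y → a + x * y) 0#

record ValuedFieldHom (K L : ValuedField c ℓ) : Set (c ⊔ ℓ) where
  private
    module K = ValuedField K
    module L = ValuedField L
  field
    fieldHom : FieldHom K.field′ L.field′

  open FieldHom fieldHom public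

  field
    v-preserved : ∀ x → L.v ⟦ x ⟧ ≡ K.v x

record Completion (K : ValuedField c ℓ) : Set (lsuc (c ⊔ ℓ)) where
  private module K = ValuedField K
  field
    valuedField : ValuedField c ℓ
    embedding   : ValuedFieldHom K valuedField

  open ValuedField valuedField
  open ValuedFieldHom embedding using (⟦_⟧)

  field
    dense    : ∀ x (B : ℚ) → ∃[ y ] [ B ] ≤⁺ v (x - ⟦ y ⟧)
    complete : ∀ x → Cauchy x → ∃[ l ] x ⟶ l

-- An algebraic closure, with a valuation extending that of K (which is
-- unique when K is complete).
record AlgebraicClosure (K : ValuedField c ℓ) : Set (lsuc (c ⊔ ℓ)) where
  private module K = ValuedField K
  field
    valuedField : ValuedField c ℓ
    embedding   : ValuedFieldHom K valuedField

  open ValuedField valuedField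
  open ValuedFieldHom embedding using (evalAt)

  field
    algebraic : ∀ x → ∃[ n ] Σ[ a ∈ Vec K.Carrier n ] evalAt x (K.monic a) ≈ 0#
    splits    : ∀ {n} (a : Vec Carrier n) → Σ[ r ∈ Vec Carrier n ]
                RawRing._≈_ polynomialRing (monic a) ∏[X- r ]

------------------------------------------------------------------------
-- The fields attached to 𝔽_q(t)

record FiniteField (c ℓ : Level) (q : ℕ) : Set (lsuc (c ⊔ ℓ)) where
  field
    field′      : Field c ℓ
  open Field field′ public
  field
    enumeration : Inverse (≡.setoid (Fin q)) setoid

  element : Fin q → Carrier
  element = Inverse.to enumeration

-- The fraction field of k[t] with the valuation that is trivial on k and
-- takes the value e at t.  For e = 1 this forces the t-adic valuation, for
-- e = -1 the valuation - deg at the place ∞ = 1/t; in both cases t is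
-- automatically transcendental over k.
record RationalFunctionField (k : Field c ℓ) (e : ℚ) : Set (lsuc (c ⊔ ℓ)) where
  private module k = Field k
  field
    valuedField : ValuedField c ℓ

  open ValuedField valuedField

  field
    constants : FieldHom k field′
    t         : Carrier

  open FieldHom constants

  field
    fractions   : ∀ x → ∃[ P ] ∃[ Q ]
                  (¬ evalAt t Q ≈ 0#) × x ≈ evalAt t P * evalAt t Q ⁻¹
    v-constants : ∀ a → ¬ a k.≈ k.0# → v ⟦ a ⟧ ≡ [ 0ℚ ]
    v-t         : v t ≡ [ e ]

-- The tower  k[t] ⊂ F = k(t) ⊂ K ⊂ K̄  at one of the two places.
record LocalTower (k : Field c ℓ) (e : ℚ) : Set (lsuc (c ⊔ ℓ)) where
  field
    rationalFunctions : RationalFunctionField k e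
  module F = RationalFunctionField rationalFunctions
  field
    completion : Completion F.valuedField
  module K = Completion completion
  field
    closure : AlgebraicClosure K.valuedField
  module K̄ = AlgebraicClosure closure

  K→K̄ : ValuedField.Carrier K.valuedField → ValuedField.Carrier K̄.valuedField
  K→K̄ = ValuedFieldHom.⟦_⟧ K̄.embedding

  F→K̄ : ValuedField.Carrier F.valuedField → ValuedField.Carrier K̄.valuedField
  F→K̄ x = K→K̄ (ValuedFieldHom.⟦_⟧ K.embedding x)

  k[t]→K̄ : List (Field.Carrier k) → ValuedField.Carrier K̄.valuedField
  k[t]→K̄ f = F→K̄ (FieldHom.evalAt F.constants F.t f)

-- K is K_∞ = 𝔽_q((1/t)) and the final completion is C_∞.
record TowerAtInfinity (k : Field c ℓ) : Set (lsuc (c ⊔ ℓ)) where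
  field
    localTower : LocalTower k (ℚ.- 1ℚ)
  open LocalTower localTower public
  field
    completionOfClosure : Completion K̄.valuedField

  module C∞ = Completion completionOfClosure

  K̄→C∞ : ValuedField.Carrier K̄.valuedField → ValuedField.Carrier C∞.valuedField
  K̄→C∞ = ValuedFieldHom.⟦_⟧ C∞.embedding

-- K is 𝔽_q((t)).
Tower-t : (k : Field c ℓ) → Set (lsuc (c ⊔ ℓ))
Tower-t k = LocalTower k 1ℚ

------------------------------------------------------------------------
-- Drinfeld cusp forms for Γ₀(t)

module Drinfeld {q : ℕ} (𝔽q : FiniteField c ℓ q)
                (∞ : TowerAtInfinity (FiniteField.field′ 𝔽q)) where

  private
    module 𝔽q = FiniteField 𝔽q
    module ∞ = TowerAtInfinity ∞
    module 𝔽q[t] = RawRing 𝔽q.polynomialRing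
    module K∞ = ValuedField ∞.K.valuedField

  open ValuedField ∞.C∞.valuedField

  K∞→C∞ : K∞.Carrier → Carrier
  K∞→C∞ x = ∞.K̄→C∞ (∞.K→K̄ x)

  ⟦_⟧ : 𝔽q[t].Carrier → Carrier
  ⟦ f ⟧ = ∞.K̄→C∞ (∞.k[t]→K̄ f)

  t : Carrier
  t = ⟦ 𝔽q.indeterminate ⟧

  -- ℙ¹(C_∞) - ℙ¹(K_∞) = C_∞ - K_∞
  Ω : Carrier → Set (c ⊔ ℓ)
  Ω z = ∀ x → ¬ z ≈ K∞→C∞ x

  -- A function on Ω is represented by a function on C_∞ whose values
  -- outside Ω are irrelevant.
  Function : Set c
  Function = Carrier → Carrier

  infix 4 _≈Ω_
  _≈Ω_ : Function → Function → Set (c ⊔ ℓ)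
  φ ≈Ω ψ = ∀ z → Ω z → φ z ≈ ψ z

  WellDefined : Function → Set (c ⊔ ℓ)
  WellDefined φ = ∀ z w → Ω z → Ω w → z ≈ w → φ z ≈ φ w

  -- |z| ≤ q ^ n  and  |z - x| ≥ q ^ (- n) for all x in K_∞.  These
  -- affinoids form the standard admissible covering of Ω.
  Affinoid : ℕ → Carrier → Set c
  Affinoid n z = ([ ℚ.- (+ n ℚ./ 1) ] ≤⁺ v z)
               × (∀ x → v (z - K∞→C∞ x) ≤⁺ [ + n ℚ./ 1 ])

  -- On each affinoid, φ is a uniform limit of rational functions P / Q
  -- without poles there.
  RigidAnalytic : Function → Set (c ⊔ ℓ)
  RigidAnalytic φ = ∀ n (B : ℚ) → ∃[ P ] ∃[ Q ]
      (∀ z → Affinoid n z → ¬ evalSelf z Q ≈ 0#)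
    × (∀ z → Affinoid n z → [ B ] ≤⁺ v (φ z - evalSelf z P * evalSelf z Q ⁻¹))

  record GL₂𝔽q[t] : Set (c ⊔ ℓ) where
    field
      a b c′ d : 𝔽q[t].Carrier

    det : 𝔽q[t].Carrier
    det = a 𝔽q[t].* d 𝔽q[t].+ 𝔽q[t].- (b 𝔽q[t].* c′)

    -- 𝔽_q[t]ˣ = 𝔽_qˣ
    field
      det-unit : ∃[ δ ] (¬ δ 𝔽q.≈ 𝔽q.0#) × det 𝔽q[t].≈ 𝔽q.const δ

  Γ₀⟨t⟩ : GL₂𝔽q[t] → Set ℓ
  Γ₀⟨t⟩ γ = 𝔽q.coeff (GL₂𝔽q[t].c′ γ) 0 𝔽q.≈ 𝔽q.0#

  slash : ℤ → ℤ → Function → GL₂𝔽q[t] → Function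
  slash k m φ γ z = φ ((⟦ a ⟧ * z + ⟦ b ⟧) * (⟦ c′ ⟧ * z + ⟦ d ⟧) ⁻¹)
                  * ⟦ det ⟧ ^ℤ m * (⟦ c′ ⟧ * z + ⟦ d ⟧) ^ℤ (ℤ.- k)
    where open GL₂𝔽q[t] γ

  polynomialsBelow : ℕ → List 𝔽q[t].Carrier
  polynomialsBelow zero    = 𝔽q[t].0# ∷ []
  polynomialsBelow (suc N) = List.cartesianProductWith _∷_
    (List.tabulate 𝔽q.element) (polynomialsBelow N)

  -- u is the value at z of 1 / e_L = Σ_{λ ∈ L} 1 / (z - λ), where
  -- e_L(z) = z ∏_{0 ≠ λ ∈ L} (1 - z / λ) and L = t 𝔽_q[t].  Translations by
  -- L lie in every conjugate of Γ₀(t) in GL₂(𝔽_q[t]), so this one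
  -- parameter serves at all cusps.
  IsParameter : Carrier → Carrier → Set
  IsParameter z u = (λ N → List.foldr (λ f y → (z - t * ⟦ f ⟧) ⁻¹ + y) 0#
                                      (polynomialsBelow N)) ⟶ u

  -- φ(z) = Σ_i (a i) u(z)^i for all z whose distance to K_∞ is large enough
  HasExpansion : Function → (ℕ → Carrier) → Set (c ⊔ ℓ)
  HasExpansion φ a = ∃[ ρ ] ∀ z → Ω z → (∀ x → v (z - K∞→C∞ x) ≤⁺ [ ρ ]) →
    ∀ u → IsParameter z u →
    (λ N → sum λ (i : Fin N) → a (toℕ i) * u ^ toℕ i) ⟶ φ z

  record IsCuspForm (k m : ℤ) (φ : Function) : Set (c ⊔ ℓ) where
    field
      wellDefined   : WellDefined φ
      rigidAnalytic : RigidAnalytic φ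
      modular       : ∀ γ → Γ₀⟨t⟩ γ → slash k m φ γ ≈Ω φ
      -- GL₂(𝔽_q[t]) permutes the cusps ℙ¹(𝔽_q(t)) transitively.
      cusps         : ∀ γ → ∃[ a ] HasExpansion (slash k m φ γ) a × a 0 ≈ 0#

  U : Function → Function
  U φ z = sum λ (i : Fin q) → φ ((z + ⟦ 𝔽q.const (𝔽q.element i) ⟧) * t ⁻¹)

  linearCombination : ∀ {n} → (Fin n → Carrier) → (Fin n → Function) → Function
  linearCombination x e z = sum λ i → x i * e i z

  record IsBasis (k m : ℤ) {n} (e : Fin n → Function) : Set (c ⊔ ℓ) where
    field
      cuspForms   : ∀ i → IsCuspForm k m (e i)
      independent : ∀ x → linearCombination x e ≈Ω (λ _ → 0#) → ∀ i → x i ≈ 0#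
      spanning    : ∀ φ → IsCuspForm k m φ → ∃[ x ] φ ≈Ω linearCombination x e

  -- columns hold the coordinates of the images of the basis vectors
  IsMatrixOfU : ∀ {n} → (Fin n → Function) → Matrix Carrier n → Set (c ⊔ ℓ)
  IsMatrixOfU e A = ∀ b → U (e b) ≈Ω linearCombination (λ a → A a b) e

  -- The monic polynomial with lower coefficients P, in 𝔽_q[t][X], is the
  -- characteristic polynomial of U_t: its image in C_∞[X] is det (X - A) for
  -- the matrix A of U_t in any basis.
  IsCharPolyOfU : ∀ (k m : ℤ) {n} → Vec 𝔽q[t].Carrier n → Set (c ⊔ ℓ)
  IsCharPolyOfU k m {n} P = ∀ (e : Fin n → Function) A →
    IsBasis k m e → IsMatrixOfU e A →
    RawRing._≈_ polynomialRing (monic (Vec.map ⟦_⟧ P)) (charPoly rawRing A)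

------------------------------------------------------------------------
-- The explicit matrix of U_t

-- Indices are shifted: a : Fin n stands for toℕ a + 1 in 1, …, n.
module Explicit {q : ℕ} (𝔽q : FiniteField c ℓ q) (j n : ℕ) where
  open FiniteField 𝔽q
  private module 𝔽q[t] = RawRing polynomialRing

  binom : ℕ → ℕ → Carrier
  binom x y = (x C y) · 1#

  up down : Fin n → ℕ
  up a   = j ℕ.+ toℕ a ℕ.* (q ∸ 1)
  down a = j ℕ.+ (n ∸ suc (toℕ a)) ℕ.* (q ∸ 1)

  M : Matrix Carrier n
  M a b = if does (a Fin.≟ b)
    then (- 1#) ^ j * binom (down a) (up a)
    else - (binom (down a) (down b) + (- 1#) ^ suc j * binom (down a) (up b))

  s : Fin n → ℕ
  s i = j ℕ.+ 1 ℕ.+ toℕ i ℕ.* (q ∸ 1)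

  MD : Matrix 𝔽q[t].Carrier n
  MD a b = const (M a b) 𝔽q[t].* indeterminate ^ᴾ s b
    where open RawSemiringDefs 𝔽q[t].rawSemiring renaming (_^_ to _^ᴾ_)

------------------------------------------------------------------------
-- Slopes

module Slopes {k : Field c ℓ} (τ : Tower-t k)
              {n : ℕ} (P : Vec (List (Field.Carrier k)) n) where
  private module τ = LocalTower τ
  open ValuedField τ.K̄.valuedField

  -- the roots, with multiplicity, of the monic polynomial with lower
  -- coefficients P
  roots : Vec Carrier n
  roots = proj₁ (τ.K̄.splits (Vec.map τ.k[t]→K̄ P))

  multiplicity : ℚ → ℕ
  multiplicity α = Vec.count (λ r → ≡-dec ℚ._≟_ (v r) [ α ]) roots

  IsSlope : ℚ → Set
  IsSlope α = 1 ℕ.≤ multiplicity α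

{-# OPTIONS --safe #-}

-- Every entry of column i of M D is a constant times t ^ s i, where
-- s 1 = j + 1 and s i ≥ j + 2 for i ≥ 2; nothing else about M matters.  Put
-- α = j + 2 and let w be the Gauss valuation on polynomials over an algebraic
-- closure of 𝔽_q((t)) with w(X) = α.  Column 1 of X - M D has w ≥ α - 1 and
-- the other columns have w ≥ α, so that w(det (X - M D)) ≥ n α - 1.  On the
-- other hand w(∏ (X - r)) = ∑ min(α, v r).  Hence ∑ (α - min(α, v r)) ≤ 1:
-- every root has valuation at least α - 1, and at most one attains it.
-- The characteristic polynomial is given over C_∞ and the slopes are read
-- off over 𝔽_q((t)); both places are compared through 𝔽_q[t], which embeds
-- in C_∞.

module Submission where

open import Defs
open import Algebra.Bundles using (CommutativeRing; RawRing)
import Algebra.Definitions.RawMonoid as RawMonoidDefs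
import Algebra.Definitions.RawSemiring as RawSemiringDefs
import Algebra.Morphism.Construct.Composition as Compose
open import Algebra.Morphism.Structures using (IsRingHomomorphism)
import Algebra.Properties.CommutativeSemigroup as CommutativeSemigroupProperties
import Algebra.Properties.Ring as RingProperties
open import Data.Bool.Base using (true; false; if_then_else_)
open import Data.Empty using (⊥-elim)
open import Data.Fin.Base using (Fin; zero; suc; toℕ; punchIn)
import Data.Fin.Properties as Fin
open import Data.Integer.Base as ℤ using (ℤ; +_)
open import Data.Integer.Divisibility using () renaming (_∣_ to _∣ℤ_)
import Data.Integer.Properties as ℤ
open import Data.List.Base as List using (List; []; _∷_)
open import Data.List.Relation.Binary.Pointwise.Base using (Pointwise; []; _∷_)
open import Data.Maybe.Properties using (just-injective)
open import Data.Nat.Base as ℕ using (ℕ; zero; suc; z≤n; s≤s)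
open import Data.Nat.Primality using (Prime; prime⇒nonTrivial)
import Data.Nat.Properties as ℕ
open import Data.Product.Base using (_×_; _,_; ∃-syntax; proj₂)
open import Data.Rational.Base as ℚ using (ℚ; 0ℚ; 1ℚ)
import Data.Rational.Properties as ℚ
open import Data.Rational.Solver using (module +-*-Solver)
open import Data.Rational.Unnormalised.Base as ℚᵘ using (mkℚᵘ; *≡*)
import Data.Rational.Unnormalised.Properties as ℚᵘ
open import Data.Sum.Base using (_⊎_; inj₁; inj₂)
open import Data.Vec.Base as Vec using (Vec)
open import Function.Construct.Symmetry using (inverse)
open import Function.Properties.Inverse using (Inverse⇒Injection)
open import Level using (Level; _⊔_)
open import Relation.Binary.Construct.Add.Supremum.NonStrict ℚ._≤_
  using ([_]; _≤⊤⁺; [≤]-injective; ≤⁺-trans; ≤⁺-dec; ≤⁺-total; ≤⁺-antisym-≡)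
open import Relation.Binary.Core using (REL)
open import Relation.Binary.Definitions using (Decidable)
open import Relation.Binary.PropositionalEquality as ≡ using (_≡_; cong; cong₂; subst)
import Relation.Binary.Reasoning.Setoid as SetoidReasoning
open import Relation.Nullary.Construct.Add.Supremum using (_⁺; ⊤⁺; [_]; ≡-dec)
open import Relation.Nullary.Decidable using (via-injection)
open import Relation.Nullary.Decidable.Core using (yes; no; does)
open import Relation.Nullary.Negation.Core using (¬_)

open import Algebra.Properties.CommutativeMonoid.Sum ℚ.+-0-commutativeMonoid
  using (sum-remove; sum-replicate) renaming (sum to ∑)
open RawMonoidDefs ℚ.+-0-rawMonoid using () renaming (_×_ to _ℚ×_)
open +-*-Solver using (solve; _:=_; _:+_; _:-_; _:*_; con)

private
  variable
    a b c ℓ ℓ₁ ℓ₂ : Level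

-- Relational parametricity for polynomials and determinants.

-- Parametricity: a relation between raw rings which is compatible with the
-- operations relates the characteristic polynomials of related matrices.
-- Applied to the graph of a homomorphism, this needs no ring laws.
record IsRingRelation (R : RawRing a ℓ₁) (S : RawRing b ℓ₂)
                      (_~_ : REL (RawRing.Carrier R) (RawRing.Carrier S) ℓ) :
                      Set (a ⊔ b ⊔ ℓ) where
  private
    module R = RawRing R
    module S = RawRing S
  field
    +-resp : ∀ {x x′ y y′} → x ~ x′ → y ~ y′ → (x R.+ y) ~ (x′ S.+ y′)
    *-resp : ∀ {x x′ y y′} → x ~ x′ → y ~ y′ → (x R.* y) ~ (x′ S.* y′)
    neg-resp : ∀ {x x′} → x ~ x′ → (R.- x) ~ (S.- x′)
    0-resp : R.0# ~ S.0#
    1-resp : R.1# ~ S.1#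

module _ {R : RawRing a ℓ₁} {S : RawRing b ℓ₂}
         {_~_ : REL (RawRing.Carrier R) (RawRing.Carrier S) ℓ}
         (rel : IsRingRelation R S _~_) where
  open IsRingRelation rel
  private
    module R = RawRing R
    module S = RawRing S
    module R[X] = Polynomial R
    module S[X] = Polynomial S
    module R^ = RawSemiringDefs R.rawSemiring
    module S^ = RawSemiringDefs S.rawSemiring

  sum-resp : ∀ {n} {f : Fin n → R.Carrier} {g : Fin n → S.Carrier} →
             (∀ i → f i ~ g i) → R^.sum f ~ S^.sum g
  sum-resp {zero}  f~g = 0-resp
  sum-resp {suc n} f~g = +-resp (f~g zero) (sum-resp λ i → f~g (suc i))

  ^-resp : ∀ {x y} → x ~ y → ∀ n → (x R^.^ n) ~ (y S^.^ n)
  ^-resp x~y zero    = 1-resp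
  ^-resp x~y (suc n) = *-resp x~y (^-resp x~y n)

  det-resp : ∀ {n} {A : Matrix R.Carrier n} {B : Matrix S.Carrier n} →
             (∀ a b → A a b ~ B a b) → Determinant.det R A ~ Determinant.det S B
  det-resp {zero}  A~B = 1-resp
  det-resp {suc n} A~B = sum-resp λ j →
    *-resp (^-resp (neg-resp 1-resp) (toℕ j))
      (*-resp (A~B zero j) (det-resp λ a b → A~B (suc a) (punchIn j b)))

  coeff-resp : ∀ {p r} → Pointwise _~_ p r → ∀ i → R[X].coeff p i ~ S[X].coeff r i
  coeff-resp []         i       = 0-resp
  coeff-resp (x~y ∷ pr) zero    = x~y
  coeff-resp (x~y ∷ pr) (suc i) = coeff-resp pr i

  addᴾ-resp : ∀ {p p′ r r′} → Pointwise _~_ p p′ → Pointwise _~_ r r′ →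
              Pointwise _~_ (R[X].addᴾ p r) (S[X].addᴾ p′ r′)
  addᴾ-resp []         r~       = r~
  addᴾ-resp (x~y ∷ p~) []       = x~y ∷ p~
  addᴾ-resp (x~y ∷ p~) (z ∷ r~) = +-resp x~y z ∷ addᴾ-resp p~ r~

  scale-resp : ∀ {x y p p′} → x ~ y → Pointwise _~_ p p′ →
               Pointwise _~_ (List.map (x R.*_) p) (List.map (y S.*_) p′)
  scale-resp x~y []       = []
  scale-resp x~y (z ∷ p~) = *-resp x~y z ∷ scale-resp x~y p~

  mulᴾ-resp : ∀ {p p′ r r′} → Pointwise _~_ p p′ → Pointwise _~_ r r′ →
              Pointwise _~_ (R[X].mulᴾ p r) (S[X].mulᴾ p′ r′)
  mulᴾ-resp []         r~ = []
  mulᴾ-resp (x~y ∷ p~) r~ = addᴾ-resp (scale-resp x~y r~) (0-resp ∷ mulᴾ-resp p~ r~)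

  negᴾ-resp : ∀ {p p′} → Pointwise _~_ p p′ →
              Pointwise _~_ (List.map R.-_ p) (List.map S.-_ p′)
  negᴾ-resp []       = []
  negᴾ-resp (z ∷ p~) = neg-resp z ∷ negᴾ-resp p~

  -- Lists are related entry by entry, not coefficient by coefficient: related lists have equal
  -- length, so the list operations branch identically on both sides. `coeff-resp` recovers the
  -- statement about coefficients.
  polynomial-isRingRelation :
    IsRingRelation R[X].polynomialRing S[X].polynomialRing (Pointwise _~_)
  polynomial-isRingRelation = record
    { +-resp   = addᴾ-resp
    ; *-resp   = mulᴾ-resp
    ; neg-resp = negᴾ-resp
    ; 0-resp   = []
    ; 1-resp   = 1-resp ∷ []
    }

  monic-resp : ∀ {n} (P : Vec R.Carrier n) (f : R.Carrier → S.Carrier) →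
               (∀ x → x ~ f x) → Pointwise _~_ (R[X].monic P) (S[X].monic (Vec.map f P))
  monic-resp Vec.[]      f f-graph = 1-resp ∷ []
  monic-resp (x Vec.∷ P) f f-graph = f-graph x ∷ monic-resp P f f-graph

charPoly-resp : {R : RawRing a ℓ₁} {S : RawRing b ℓ₂}
                {_~_ : REL (RawRing.Carrier R) (RawRing.Carrier S) ℓ} →
                IsRingRelation R S _~_ →
                ∀ {n} (A : Matrix (RawRing.Carrier R) n) (B : Matrix (RawRing.Carrier S) n) →
                (∀ a b → A a b ~ B a b) →
                Pointwise _~_ (charPoly R A) (charPoly S B)
charPoly-resp {R = R} {S} {_~_} rel A B A~B =
  det-resp polyRel λ a b → addᴾ-resp rel (diagonal (does (a Fin.≟ b)))
                                         (negᴾ-resp rel (A~B a b ∷ []))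
  where
  open IsRingRelation rel
  polyRel = polynomial-isRingRelation rel

  -- Whether an entry is diagonal depends on the indices alone, so one Boolean decides the branch
  -- over both rings.
  diagonal : ∀ t → Pointwise _~_
    (if t then Polynomial.indeterminate R else [])
    (if t then Polynomial.indeterminate S else [])
  diagonal true  = 0-resp ∷ 1-resp ∷ []
  diagonal false = []

-- Coefficients and evaluation of list polynomials.

module Coefficients (R : CommutativeRing c ℓ) where
  open CommutativeRing R
  open Polynomial rawRing
  open RingProperties ring using (-0#≈0#)

  coeff-addᴾ : ∀ p r i → coeff (addᴾ p r) i ≈ coeff p i + coeff r i
  coeff-addᴾ []      r       i       = sym (+-identityˡ _)
  coeff-addᴾ (a ∷ p) []      i       = sym (+-identityʳ _)
  coeff-addᴾ (a ∷ p) (b ∷ r) zero    = refl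
  coeff-addᴾ (a ∷ p) (b ∷ r) (suc i) = coeff-addᴾ p r i

  coeff-scale : ∀ a p i → coeff (List.map (a *_) p) i ≈ a * coeff p i
  coeff-scale a []      i       = sym (zeroʳ a)
  coeff-scale a (b ∷ p) zero    = refl
  coeff-scale a (b ∷ p) (suc i) = coeff-scale a p i

  coeff-negᴾ : ∀ p i → coeff (List.map (-_) p) i ≈ - coeff p i
  coeff-negᴾ []      i       = sym -0#≈0#
  coeff-negᴾ (b ∷ p) zero    = refl
  coeff-negᴾ (b ∷ p) (suc i) = coeff-negᴾ p i

  -- This is the recursion by which the Gauss valuation of a product of linear factors is followed,
  -- one root at a time.
  coeff-mulᴾ-linear : ∀ r p i →
    coeff (mulᴾ (- r ∷ 1# ∷ []) p) i ≈ coeff (0# ∷ p) i + - r * coeff p i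
  coeff-mulᴾ-linear r p i = begin
    coeff (addᴾ (List.map (- r *_) p) (0# ∷ X·p)) i    ≈⟨ coeff-addᴾ (List.map (- r *_) p) (0# ∷ X·p) i ⟩
    coeff (List.map (- r *_) p) i + coeff (0# ∷ X·p) i ≈⟨ +-cong (coeff-scale (- r) p i) (shift i) ⟩
    - r * coeff p i + coeff (0# ∷ p) i                 ≈⟨ +-comm _ _ ⟩
    coeff (0# ∷ p) i + - r * coeff p i                 ∎
    where
    open SetoidReasoning setoid
    -- Unfolding the product leaves a factor `1#`, which gives back `p` only up to coefficients:
    -- every entry is multiplied by `1#` and the list `0# ∷ []` is added.
    X·p = mulᴾ (1# ∷ []) p

    coeff-[0] : ∀ i → coeff (0# ∷ []) i ≈ 0#
    coeff-[0] zero    = refl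
    coeff-[0] (suc i) = refl

    shift : ∀ i → coeff (0# ∷ X·p) i ≈ coeff (0# ∷ p) i
    shift zero    = refl
    shift (suc i) = begin
      coeff X·p i                                          ≈⟨ coeff-addᴾ (List.map (1# *_) p) (0# ∷ []) i ⟩
      coeff (List.map (1# *_) p) i + coeff (0# ∷ []) i     ≈⟨ +-cong (coeff-scale 1# p i) (coeff-[0] i) ⟩
      1# * coeff p i + 0#                                  ≈⟨ +-identityʳ _ ⟩
      1# * coeff p i                                       ≈⟨ *-identityˡ _ ⟩
      coeff p i                                            ∎

module Evaluation {K L : Field c ℓ} (h : FieldHom K L) (x : Field.Carrier L) where
  private
    module K = Field K
    module L = Field L
  open L
  open FieldHom h
  open IsRingHomomorphism isHomomorphism
  open CommutativeSemigroupProperties +-commutativeSemigroup using (interchange)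
  open CommutativeSemigroupProperties *-commutativeSemigroup using (x∙yz≈y∙xz)
  open RingProperties ring using (-‿+-comm; -‿distribʳ-*; -0#≈0#)
  open SetoidReasoning setoid

  private
    ev : List K.Carrier → Carrier
    ev = evalAt x

  evalAt-0 : ∀ p → (∀ i → K.coeff p i K.≈ K.0#) → ev p ≈ 0#
  evalAt-0 []      p≈0 = refl
  evalAt-0 (a ∷ p) p≈0 = begin
    ⟦ a ⟧ + x * ev p  ≈⟨ +-cong (trans (⟦⟧-cong (p≈0 0)) 0#-homo) (*-congˡ (evalAt-0 p λ i → p≈0 (suc i))) ⟩
    0# + x * 0#       ≈⟨ +-identityˡ _ ⟩
    x * 0#            ≈⟨ zeroʳ x ⟩
    0#                ∎

  -- Equal polynomials may be lists of different lengths. Once the shorter list is exhausted, the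
  -- rest of the other has vanishing coefficients and `evalAt-0` applies.
  evalAt-cong : ∀ p r → (∀ i → K.coeff p i K.≈ K.coeff r i) → ev p ≈ ev r
  evalAt-cong []      r       p≈r = sym (evalAt-0 r λ i → K.sym (p≈r i))
  evalAt-cong (a ∷ p) []      p≈r = evalAt-0 (a ∷ p) p≈r
  evalAt-cong (a ∷ p) (b ∷ r) p≈r =
    +-cong (⟦⟧-cong (p≈r 0)) (*-congˡ (evalAt-cong p r λ i → p≈r (suc i)))

  evalAt-+ : ∀ p r → ev (K.addᴾ p r) ≈ ev p + ev r
  evalAt-+ []      r       = sym (+-identityˡ _)
  evalAt-+ (a ∷ p) []      = sym (+-identityʳ _)
  evalAt-+ (a ∷ p) (b ∷ r) = begin
    ⟦ a K.+ b ⟧ + x * ev (K.addᴾ p r)          ≈⟨ +-cong (+-homo a b) (*-congˡ (evalAt-+ p r)) ⟩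
    (⟦ a ⟧ + ⟦ b ⟧) + x * (ev p + ev r)        ≈⟨ +-congˡ (distribˡ x _ _) ⟩
    (⟦ a ⟧ + ⟦ b ⟧) + (x * ev p + x * ev r)    ≈⟨ interchange _ _ _ _ ⟩
    (⟦ a ⟧ + x * ev p) + (⟦ b ⟧ + x * ev r)    ∎

  evalAt-scale : ∀ a p → ev (List.map (a K.*_) p) ≈ ⟦ a ⟧ * ev p
  evalAt-scale a []      = sym (zeroʳ _)
  evalAt-scale a (b ∷ p) = begin
    ⟦ a K.* b ⟧ + x * ev (List.map (a K.*_) p) ≈⟨ +-cong (*-homo a b) (*-congˡ (evalAt-scale a p)) ⟩
    ⟦ a ⟧ * ⟦ b ⟧ + x * (⟦ a ⟧ * ev p)         ≈⟨ +-congˡ (x∙yz≈y∙xz _ _ _) ⟩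
    ⟦ a ⟧ * ⟦ b ⟧ + ⟦ a ⟧ * (x * ev p)         ≈⟨ distribˡ _ _ _ ⟨
    ⟦ a ⟧ * (⟦ b ⟧ + x * ev p)                 ∎

  evalAt-0∷ : ∀ p → ev (K.0# ∷ p) ≈ x * ev p
  evalAt-0∷ p = trans (+-congʳ 0#-homo) (+-identityˡ _)

  evalAt-* : ∀ p r → ev (K.mulᴾ p r) ≈ ev p * ev r
  evalAt-* []      r = sym (zeroˡ _)
  evalAt-* (a ∷ p) r = begin
    ev (K.addᴾ a·r (K.0# ∷ K.mulᴾ p r))     ≈⟨ evalAt-+ a·r (K.0# ∷ K.mulᴾ p r) ⟩
    ev a·r + ev (K.0# ∷ K.mulᴾ p r)         ≈⟨ +-cong (evalAt-scale a r) (evalAt-0∷ (K.mulᴾ p r)) ⟩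
    ⟦ a ⟧ * ev r + x * ev (K.mulᴾ p r)      ≈⟨ +-congˡ (*-congˡ (evalAt-* p r)) ⟩
    ⟦ a ⟧ * ev r + x * (ev p * ev r)        ≈⟨ +-congˡ (*-assoc _ _ _) ⟨
    ⟦ a ⟧ * ev r + (x * ev p) * ev r        ≈⟨ distribʳ _ _ _ ⟨
    (⟦ a ⟧ + x * ev p) * ev r               ∎
    where a·r = List.map (a K.*_) r

  evalAt-neg : ∀ p → ev (List.map K.-_ p) ≈ - ev p
  evalAt-neg []      = sym -0#≈0#
  evalAt-neg (a ∷ p) = begin
    ⟦ K.- a ⟧ + x * ev (List.map K.-_ p)  ≈⟨ +-cong (-‿homo a) (*-congˡ (evalAt-neg p)) ⟩
    - ⟦ a ⟧ + x * - ev p                  ≈⟨ +-congˡ (-‿distribʳ-* x _) ⟨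
    - ⟦ a ⟧ + - (x * ev p)                ≈⟨ -‿+-comm _ _ ⟩
    - (⟦ a ⟧ + x * ev p)                  ∎

  evalAt-const : ∀ a → ev (K.const a) ≈ ⟦ a ⟧
  evalAt-const a = trans (+-congˡ (zeroʳ x)) (+-identityʳ _)

  evalAt-indeterminate : ev K.indeterminate ≈ x
  evalAt-indeterminate = begin
    ev (K.0# ∷ K.const K.1#)  ≈⟨ evalAt-0∷ (K.const K.1#) ⟩
    x * ev (K.const K.1#)     ≈⟨ *-congˡ (trans (evalAt-const K.1#) 1#-homo) ⟩
    x * 1#                    ≈⟨ *-identityʳ x ⟩
    x                         ∎

  evalAt-isRingHomomorphism : IsRingHomomorphism K.polynomialRing rawRing ev
  evalAt-isRingHomomorphism = record
    { isSemiringHomomorphism = record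
      { isNearSemiringHomomorphism = record
        { +-isMonoidHomomorphism = record
          { isMagmaHomomorphism = record
            { isRelHomomorphism = record { cong = λ {p} {r} → evalAt-cong p r }
            ; homo              = evalAt-+
            }
          ; ε-homo = refl
          }
        ; *-homo = evalAt-*
        }
      ; 1#-homo = trans (evalAt-const K.1#) 1#-homo
      }
    ; -‿homo = evalAt-neg
    }

-- The source may be a mere raw ring, as the lists representing `𝔽_q[t]` are; congruence and
-- transitivity are used only in the target.
graph-isRingRelation :
  ∀ {R : RawRing a ℓ₁} (S : CommutativeRing b ℓ₂) {f} →
  IsRingHomomorphism R (CommutativeRing.rawRing S) f →
  IsRingRelation R (CommutativeRing.rawRing S) (λ x y → CommutativeRing._≈_ S (f x) y)
graph-isRingRelation S f-hom = record
  { +-resp   = λ x y → trans (+-homo _ _) (+-cong x y)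
  ; *-resp   = λ x y → trans (*-homo _ _) (*-cong x y)
  ; neg-resp = λ x → trans (-‿homo _) (-‿cong x)
  ; 0-resp   = 0#-homo
  ; 1-resp   = 1#-homo
  }
  where
  open CommutativeRing S
  open IsRingHomomorphism f-hom

-- Lower bounds, weak and strict, for a valuation.

module Valuation (V : ValuedField c ℓ) where
  open ValuedField V hiding (zero)
  open RingProperties ring using (-1*x≈-x; -‿involutive; //-rightDividesʳ)

  infix 4 _≽_ _≻_
  -- The strict bound is a negation, so that an element of value `⊤⁺` lies strictly above every
  -- rational `B`.
  _≽_ _≻_ : Carrier → ℚ → Set
  x ≽ B = [ B ] ≤⁺ v x
  x ≻ B = ¬ (v x ≤⁺ [ B ])

  ≽-weaken : ∀ {x B B′} → B′ ℚ.≤ B → x ≽ B → x ≽ B′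
  ≽-weaken B′≤B = ≤⁺-trans ℚ.≤-trans [ B′≤B ]

  ≽⇒≻ : ∀ {x B B′} → B′ ℚ.< B → x ≽ B → x ≻ B′
  ≽⇒≻ B′<B x≽B vx≤B′ = ℚ.<-irrefl ≡.refl (ℚ.<-≤-trans B′<B ([≤]-injective (≤⁺-trans ℚ.≤-trans x≽B vx≤B′)))

  ≻⇒≽ : ∀ {x B} → x ≻ B → x ≽ B
  ≻⇒≽ {x} {B} x≻B with ≤⁺-total ℚ.≤-total [ B ] (v x)
  ... | inj₁ x≽B  = x≽B
  ... | inj₂ vx≤B = ⊥-elim (x≻B vx≤B)

  ≡⇒≽ : ∀ {x B} → v x ≡ [ B ] → x ≽ B
  ≡⇒≽ vx≡B rewrite vx≡B = [ ℚ.≤-refl ]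

  ≽-cong : ∀ {x y B} → x ≈ y → x ≽ B → y ≽ B
  ≽-cong x≈y = subst (_ ≤⁺_) (v-cong x≈y)

  ≻-cong : ∀ {x y B} → x ≈ y → x ≻ B → y ≻ B
  ≻-cong x≈y x≻B vy≤B = x≻B (subst (_≤⁺ _) (≡.sym (v-cong x≈y)) vy≤B)

  0≽ : ∀ B → 0# ≽ B
  0≽ B rewrite v-0 = [ B ] ≤⊤⁺

  0≻ : ∀ B → 0# ≻ B
  0≻ B v0≤B rewrite v-0 with () ← v0≤B

  ≽-* : ∀ {x y B C} → x ≽ B → y ≽ C → x * y ≽ B ℚ.+ C
  ≽-* {x} {y} x≽B y≽C rewrite v-* x y with v x | v y | x≽B | y≽C
  ... | [ _ ] | [ _ ] | [ p ] | [ q ] = [ ℚ.+-mono-≤ p q ]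
  ... | [ _ ] | ⊤⁺    | _     | _     = _ ≤⊤⁺
  ... | ⊤⁺    | _     | _     | _     = _ ≤⊤⁺

  ≽-*-≻ : ∀ {x y B C} → x ≽ B → y ≻ C → x * y ≻ B ℚ.+ C
  ≽-*-≻ {x} {y} {B} {C} x≽B y≻C rewrite v-* x y = lemma (v x) (v y) x≽B y≻C
    where
    lemma : ∀ v w → [ B ] ≤⁺ v → ¬ w ≤⁺ [ C ] → ¬ v +⁺ w ≤⁺ [ B ℚ.+ C ]
    -- If either value is `⊤⁺`, so is the sum, which has no finite upper bound; only finite values
    -- remain.
    lemma [ v ] [ w ] [ B≤v ] w≰C [ v+w≤B+C ] = ℚ.<-irrefl ≡.refl
      (ℚ.<-≤-trans (ℚ.+-mono-≤-< B≤v (ℚ.≰⇒> λ w≤C → w≰C [ w≤C ])) v+w≤B+C)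

  ≽-+ : ∀ {x y B} → x ≽ B → y ≽ B → x + y ≽ B
  ≽-+ {x} {y} x≽B y≽B with ≤⁺-total ℚ.≤-total (v x) (v y)
  ... | inj₁ vx≤vy = ≤⁺-trans ℚ.≤-trans x≽B (v-ultrametric x y vx≤vy)
  ... | inj₂ vy≤vx = ≽-cong (+-comm y x) (≤⁺-trans ℚ.≤-trans y≽B (v-ultrametric y x vy≤vx))

  ≻-+ : ∀ {x y B} → x ≻ B → y ≻ B → x + y ≻ B
  ≻-+ {x} {y} x≻B y≻B v≤B with ≤⁺-total ℚ.≤-total (v x) (v y)
  ... | inj₁ vx≤vy = x≻B (≤⁺-trans ℚ.≤-trans (v-ultrametric x y vx≤vy) v≤B)
  ... | inj₂ vy≤vx = y≻B (≤⁺-trans ℚ.≤-trans (v-ultrametric y x vy≤vx)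
          (subst (_≤⁺ _) (v-cong (+-comm x y)) v≤B))

  -- From `1 * 1 = 1` the value of 1 is idempotent, and it is finite because `1#` is not zero.
  v-1 : v 1# ≡ [ 0ℚ ]
  v-1 = idempotent (v 1#) (λ v1≡⊤ → 1≉0 (v-⊤ 1# v1≡⊤))
                   (≡.trans (≡.sym (v-* 1# 1#)) (v-cong (*-identityʳ 1#)))
    where
    idempotent : ∀ w → ¬ w ≡ ⊤⁺ → w +⁺ w ≡ w → w ≡ [ 0ℚ ]
    idempotent ⊤⁺    w≢⊤ _  = ⊥-elim (w≢⊤ ≡.refl)
    idempotent [ x ] _   eq = cong [_]
      (RingProperties.x+x≈x⇒x≈0 ℚ.+-*-ring x (just-injective eq))

  -- The square of -1 is 1, so twice its value is 0.
  v[-1] : v (- 1#) ≡ [ 0ℚ ]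
  v[-1] = half (v (- 1#)) (≡.trans (≡.sym (v-* (- 1#) (- 1#)))
            (≡.trans (v-cong (trans (-1*x≈-x (- 1#)) (-‿involutive 1#))) v-1))
    where
    half : ∀ w → w +⁺ w ≡ [ 0ℚ ] → w ≡ [ 0ℚ ]
    half [ x ] eq = cong [_] (begin
      x                      ≡⟨ solve 1 (λ x → x := con ℚ.½ :* (x :+ x)) ≡.refl x ⟩
      ℚ.½ ℚ.* (x ℚ.+ x)      ≡⟨ cong (ℚ.½ ℚ.*_) (just-injective eq) ⟩
      0ℚ                     ∎)
      where open ≡.≡-Reasoning

  v-neg : ∀ x → v (- x) ≡ v x
  v-neg x = begin
    v (- x)               ≡⟨ v-cong (-1*x≈-x x) ⟨
    v (- 1# * x)          ≡⟨ v-* (- 1#) x ⟩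
    v (- 1#) +⁺ v x       ≡⟨ cong (_+⁺ v x) v[-1] ⟩
    [ 0ℚ ] +⁺ v x         ≡⟨ 0+⁺ (v x) ⟩
    v x                   ∎
    where
    open ≡.≡-Reasoning
    0+⁺ : ∀ w → [ 0ℚ ] +⁺ w ≡ w
    0+⁺ ⊤⁺    = ≡.refl
    0+⁺ [ y ] = cong [_] (ℚ.+-identityˡ y)

  ≽-neg : ∀ {x B} → x ≽ B → - x ≽ B
  ≽-neg {x} = subst (_ ≤⁺_) (≡.sym (v-neg x))

  ≻-neg : ∀ {x B} → x ≻ B → - x ≻ B
  ≻-neg {x} x≻B vx≤B = x≻B (subst (_≤⁺ _) (v-neg x) vx≤B)

  ≽-^ : ∀ {x B} → x ≽ B → ∀ n → x ^ n ≽ n ℚ× B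
  ≽-^ x≽B zero    = ≡⇒≽ v-1
  ≽-^ x≽B (suc n) = ≽-* x≽B (≽-^ x≽B n)

  -- If v y > B then x = (x + y) - y excludes v (x + y) > B.
  v-dominant : ∀ {x y B} → v x ≡ [ B ] → y ≻ B → v (x + y) ≡ [ B ]
  v-dominant {x} {y} {B} vx≡B y≻B with ≤⁺-dec ℚ._≤?_ (v (x + y)) [ B ]
  ... | yes v≤B = ≤⁺-antisym-≡ ℚ.≤-antisym v≤B (≽-+ (≡⇒≽ vx≡B) (≻⇒≽ y≻B))
  ... | no  v≰B = ⊥-elim (≻-cong (//-rightDividesʳ y x) (≻-+ v≰B (≻-neg y≻B))
                            (subst (_≤⁺ [ B ]) (≡.sym vx≡B) [ ℚ.≤-refl ]))

-- Gauss valuation of characteristic polynomials and of products of linear factors.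

module GaussValuation (V : ValuedField c ℓ) (α : ℚ) where
  open ValuedField V hiding (zero; sum)
  open Valuation V
  open Coefficients commutativeRing
  open RawRing polynomialRing using () renaming (_+_ to _+ᴾ_; _*_ to _*ᴾ_; -_ to -ᴾ_; 1# to 1ᴾ)
  private
    module P = RawSemiringDefs (RawRing.rawSemiring polynomialRing)

  -- The Gauss valuation, normalised by w(X) = α, of p is at least C.
  record Gauss≥ (C : ℚ) (p : List Carrier) : Set where
    constructor gauss≥
    field
      coeff≽ : ∀ k → coeff p k ≽ C ℚ.- k ℚ× α

  open Gauss≥ public

  gauss-weaken : ∀ {B C p} → B ℚ.≤ C → Gauss≥ C p → Gauss≥ B p
  gauss-weaken B≤C (gauss≥ p≥C) = gauss≥ λ k → ≽-weaken (ℚ.+-monoˡ-≤ (ℚ.- (k ℚ× α)) B≤C) (p≥C k)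

  gauss-[] : ∀ {C} → Gauss≥ C []
  gauss-[] = gauss≥ λ k → 0≽ _

  gauss-const : ∀ {x C} → x ≽ C → Gauss≥ C (const x)
  gauss-const x≽C = gauss≥ λ where
    zero    → subst (_ ≽_) (≡.sym (ℚ.+-identityʳ _)) x≽C
    (suc k) → 0≽ _

  gauss-shift : ∀ {C p} → Gauss≥ C p → Gauss≥ (α ℚ.+ C) (0# ∷ p)
  gauss-shift {C} (gauss≥ p≥C) = gauss≥ λ where
    zero    → 0≽ _
    (suc k) → subst (_ ≽_)
      (solve 3 (λ C α w → C :- w := (α :+ C) :- (α :+ w)) ≡.refl C α (k ℚ× α)) (p≥C k)

  gauss-indeterminate : Gauss≥ α indeterminate
  gauss-indeterminate = subst (λ C → Gauss≥ C indeterminate) (ℚ.+-identityʳ α)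
    (gauss-shift (gauss-const (≡⇒≽ v-1)))

  gauss-+ : ∀ {C p r} → Gauss≥ C p → Gauss≥ C r → Gauss≥ C (p +ᴾ r)
  gauss-+ {C} {p} {r} (gauss≥ p≥C) (gauss≥ r≥C) = gauss≥ λ k →
    ≽-cong (sym (coeff-addᴾ p r k)) (≽-+ (p≥C k) (r≥C k))

  gauss-neg : ∀ {C p} → Gauss≥ C p → Gauss≥ C (-ᴾ p)
  gauss-neg {p = p} (gauss≥ p≥C) = gauss≥ λ k → ≽-cong (sym (coeff-negᴾ p k)) (≽-neg (p≥C k))

  gauss-scale : ∀ {x B C p} → x ≽ B → Gauss≥ C p → Gauss≥ (B ℚ.+ C) (List.map (x *_) p)
  gauss-scale {x} {B} {C} {p} x≽B (gauss≥ p≥C) = gauss≥ λ k → subst (_ ≽_) (≡.sym (ℚ.+-assoc B C _))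
    (≽-cong (sym (coeff-scale x p k)) (≽-* x≽B (p≥C k)))

  -- Induction on `p` as constant term plus X times tail: the tail satisfies the bound lowered by
  -- `α`, and `gauss-shift` restores the loss after multiplication.
  gauss-* : ∀ {B C} p {r} → Gauss≥ B p → Gauss≥ C r → Gauss≥ (B ℚ.+ C) (p *ᴾ r)
  gauss-* []      p≥B r≥C = gauss-[]
  gauss-* {B} {C} (x ∷ p) {r} p≥B r≥C = gauss-+
    (gauss-scale (subst (x ≽_) (ℚ.+-identityʳ B) (coeff≽ p≥B 0)) r≥C)
    (subst (λ D → Gauss≥ D (0# ∷ p *ᴾ r))
      (solve 3 (λ B C α → α :+ ((B :- α) :+ C) := B :+ C) ≡.refl B C α)
      (gauss-shift (gauss-* p tail≥B-α r≥C)))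
    where
    tail≥B-α : Gauss≥ (B ℚ.- α) p
    tail≥B-α = gauss≥ λ k → subst (_ ≽_)
      (solve 3 (λ B α w → B :- (α :+ w) := (B :- α) :- w) ≡.refl B α (k ℚ× α)) (coeff≽ p≥B (suc k))

  gauss-1 : Gauss≥ 0ℚ 1ᴾ
  gauss-1 = gauss-const (≡⇒≽ v-1)

  gauss-^ : ∀ {p} → Gauss≥ 0ℚ p → ∀ n → Gauss≥ 0ℚ (p P.^ n)
  gauss-^     p≥0 zero    = gauss-1
  gauss-^ {p} p≥0 (suc n) = gauss-* p p≥0 (gauss-^ p≥0 n)

  gauss-sum : ∀ {C n} (f : Fin n → List Carrier) → (∀ i → Gauss≥ C (f i)) → Gauss≥ C (P.sum f)
  gauss-sum {n = zero}  f f≥C = gauss-[]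
  gauss-sum {n = suc n} f f≥C = gauss-+ (f≥C zero) (gauss-sum (λ i → f (suc i)) (λ i → f≥C (suc i)))

  -- In the Laplace expansion the entry from column `i` meets a minor without column `i`, so every
  -- term collects each `C b` exactly once; `sum-remove` reassembles the sum, and the signs have
  -- Gauss valuation at least 0.
  gauss-det : ∀ {n} (A : Matrix (List Carrier) n) (C : Fin n → ℚ) →
              (∀ a b → Gauss≥ (C b) (A a b)) →
              Gauss≥ (∑ C) (Determinant.det polynomialRing A)
  gauss-det {zero}  A C A≥C = gauss-1
  gauss-det {suc n} A C A≥C = gauss-sum _ λ i →
    subst (λ D → Gauss≥ D (((-ᴾ 1ᴾ) P.^ toℕ i) *ᴾ (A zero i *ᴾ Determinant.det polynomialRing (minor i))))
      (≡.trans (ℚ.+-identityˡ _) (≡.sym (sum-remove {i = i} C)))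
      (gauss-* ((-ᴾ 1ᴾ) P.^ toℕ i) (gauss-^ (gauss-neg gauss-1) (toℕ i))
        (gauss-* (A zero i) (A≥C zero i)
          (gauss-det (minor i) (λ b → C (punchIn i b)) (λ a b → A≥C (suc a) (punchIn i b)))))
    where
    minor : Fin (suc n) → Matrix (List Carrier) n
    minor i a b = A (suc a) (punchIn i b)

  -- The condition `C b ≤ α` accounts for the indeterminate on the diagonal, whose Gauss valuation
  -- is `α`.
  gauss-charPoly : ∀ {n} (A : Matrix Carrier n) (C : Fin n → ℚ) →
                   (∀ b → C b ℚ.≤ α) → (∀ a b → A a b ≽ C b) →
                   Gauss≥ (∑ C) (charPoly rawRing A)
  gauss-charPoly A C C≤α A≽C = gauss-det _ C λ a b →
    gauss-+ (diagonal (does (a Fin.≟ b)) b) (gauss-neg (gauss-const (A≽C a b)))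
    where
    diagonal : ∀ t b → Gauss≥ (C b) (if t then indeterminate else [])
    diagonal true  b = gauss-weaken (C≤α b) gauss-indeterminate
    diagonal false b = gauss-[]

  -- Tracking the last coefficient that attains the Gauss valuation rules out
  -- cancellation when p is multiplied by X - r with v r = α.
  record Gauss≡ (C : ℚ) (p : List Carrier) : Set where
    field
      bound    : Gauss≥ C p
      leading  : ℕ
      attained : v (coeff p leading) ≡ [ C ℚ.- leading ℚ× α ]
      beyond   : ∀ k → leading ℕ.< k → coeff p k ≻ C ℚ.- k ℚ× α

  gauss≡-1 : Gauss≡ 0ℚ 1ᴾ
  gauss≡-1 = record
    { bound    = gauss-1
    ; leading  = 0
    ; attained = v-1
    ; beyond   = λ { (suc k) _ → 0≻ _ }
    }

  module _ {r : Carrier} {C : ℚ} {p : List Carrier} (p≡C : Gauss≡ C p) where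
    open Gauss≡ p≡C

    -- The factor X moves the last attaining index up by one. Beyond the old index the contribution
    -- of `- r` is strictly larger in value, so nothing cancels there, even when `v r` equals `α`.
    gauss≡-linear-≥ : r ≽ α → Gauss≡ (α ℚ.+ C) (mulᴾ (- r ∷ 1# ∷ []) p)
    gauss≡-linear-≥ r≽α = record
      { bound    = gauss≥ λ k → ≽-cong (sym (coeff-mulᴾ-linear r p k))
                     (≽-+ (coeff≽ (gauss-shift bound) k)
                       (≽-cong (coeff-scale (- r) p k) (coeff≽ (gauss-scale (≽-neg r≽α) bound) k)))
      ; leading  = suc leading
      ; attained = ≡.trans (v-cong (coeff-mulᴾ-linear r p (suc leading)))
                     (v-dominant (≡.trans attained (cong [_] (rearrange leading)))
                                 (r*p≻ (suc leading) ℕ.≤-refl))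
      ; beyond   = λ { (suc k) (ℕ.s≤s l<k) →
                       ≻-cong (sym (coeff-mulᴾ-linear r p (suc k)))
                         (≻-+ (subst (coeff p k ≻_) (rearrange k) (beyond k l<k))
                              (r*p≻ (suc k) (ℕ.m≤n⇒m≤1+n l<k))) }
      }
      where
      rearrange : ∀ k → C ℚ.- k ℚ× α ≡ (α ℚ.+ C) ℚ.- suc k ℚ× α
      rearrange k = solve 3 (λ C α w → C :- w := (α :+ C) :- (α :+ w)) ≡.refl C α (k ℚ× α)

      r*p≻ : ∀ k → leading ℕ.< k → - r * coeff p k ≻ (α ℚ.+ C) ℚ.- k ℚ× α
      r*p≻ k l<k = subst (_ ≻_) (≡.sym (ℚ.+-assoc α C _)) (≽-*-≻ (≽-neg r≽α) (beyond k l<k))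

    -- Here `- r` dominates: X times `p` has Gauss valuation at least `α + C`, strictly above
    -- `x + C`, so the last attaining index stays in place.
    gauss≡-linear-< : ∀ {x} → v r ≡ [ x ] → x ℚ.< α → Gauss≡ (x ℚ.+ C) (mulᴾ (- r ∷ 1# ∷ []) p)
    gauss≡-linear-< {x} vr≡x x<α = record
      { bound    = gauss≥ λ k → ≽-cong (sym (coeff-mulᴾ-linear r p k))
                     (≽-+ (≻⇒≽ (X*p≻ k))
                       (≽-cong (coeff-scale (- r) p k) (coeff≽ (gauss-scale -r≽x bound) k)))
      ; leading  = leading
      ; attained = ≡.trans (v-cong (trans (coeff-mulᴾ-linear r p leading) (+-comm _ _)))
                     (v-dominant v[r*p] (X*p≻ leading))
      ; beyond   = λ k l<k → ≻-cong (sym (coeff-mulᴾ-linear r p k))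
                     (≻-+ (X*p≻ k) (subst (_ ≻_) (≡.sym (ℚ.+-assoc x C _)) (≽-*-≻ -r≽x (beyond k l<k))))
      }
      where
      -r≽x : - r ≽ x
      -r≽x = ≽-neg (≡⇒≽ vr≡x)

      X*p≻ : ∀ k → coeff (0# ∷ p) k ≻ (x ℚ.+ C) ℚ.- k ℚ× α
      X*p≻ k = ≽⇒≻ (ℚ.+-monoˡ-< (ℚ.- (k ℚ× α)) (ℚ.+-monoˡ-< C x<α)) (coeff≽ (gauss-shift bound) k)

      v[r*p] : v (- r * coeff p leading) ≡ [ (x ℚ.+ C) ℚ.- leading ℚ× α ]
      v[r*p] = begin
        v (- r * coeff p leading)               ≡⟨ v-* _ _ ⟩
        v (- r) +⁺ v (coeff p leading)          ≡⟨ cong₂ _+⁺_ (≡.trans (v-neg r) vr≡x) attained ⟩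
        [ x ℚ.+ (C ℚ.- leading ℚ× α) ]          ≡⟨ cong [_] (ℚ.+-assoc x C _) ⟨
        [ (x ℚ.+ C) ℚ.- leading ℚ× α ]          ∎
        where open ≡.≡-Reasoning

  -- At `v r` this is the Gauss valuation of X - r; a zero root gives `α`.
  cap : ℚ ⁺ → ℚ
  cap ⊤⁺    = α
  cap [ x ] = α ℚ.⊓ x

  ∑cap : ∀ {n} → Vec Carrier n → ℚ
  ∑cap Vec.[]       = 0ℚ
  ∑cap (r Vec.∷ rs) = cap (v r) ℚ.+ ∑cap rs

  gauss≡-linear : ∀ {C p} r → Gauss≡ C p → Gauss≡ (cap (v r) ℚ.+ C) (mulᴾ (- r ∷ 1# ∷ []) p)
  gauss≡-linear r p≡C with v r in eq
  ... | ⊤⁺    = gauss≡-linear-≥ p≡C (subst ([ α ] ≤⁺_) (≡.sym eq) (_ ≤⊤⁺))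
  ... | [ x ] with x ℚ.<? α
  ...   | yes x<α rewrite ℚ.p≥q⇒p⊓q≡q (ℚ.<⇒≤ x<α) = gauss≡-linear-< p≡C eq x<α
  ...   | no  x≮α rewrite ℚ.p≤q⇒p⊓q≡p (ℚ.≮⇒≥ x≮α) =
    gauss≡-linear-≥ p≡C (subst ([ α ] ≤⁺_) (≡.sym eq) [ ℚ.≮⇒≥ x≮α ])

  gauss≡-∏ : ∀ {n} (rs : Vec Carrier n) → Gauss≡ (∑cap rs) ∏[X- rs ]
  gauss≡-∏ Vec.[]       = gauss≡-1
  gauss≡-∏ (r Vec.∷ rs) = gauss≡-linear r (gauss≡-∏ rs)

  -- It suffices to look at the coefficient of index `leading`, whose value is known exactly by
  -- `gauss≡-∏`.
  gauss≥⇒≤∑cap : ∀ {C n} (rs : Vec Carrier n) → Gauss≥ C ∏[X- rs ] → C ℚ.≤ ∑cap rs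
  gauss≥⇒≤∑cap {C} rs ∏≥C = begin
    C                          ≡⟨ cancel C ⟨
    (C ℚ.- w) ℚ.+ w            ≤⟨ ℚ.+-monoˡ-≤ w C-w≤ ⟩
    (∑cap rs ℚ.- w) ℚ.+ w      ≡⟨ cancel (∑cap rs) ⟩
    ∑cap rs                    ∎
    where
    open Gauss≡ (gauss≡-∏ rs)
    open ℚ.≤-Reasoning
    w = leading ℚ× α

    C-w≤ : C ℚ.- w ℚ.≤ ∑cap rs ℚ.- w
    C-w≤ = [≤]-injective (subst ([ C ℚ.- w ] ≤⁺_) attained (coeff≽ ∏≥C leading))

    cancel : ∀ x → (x ℚ.- w) ℚ.+ w ≡ x
    cancel x = solve 2 (λ x w → (x :- w) :+ w := x) ≡.refl x w

  cap≤α : ∀ w → cap w ℚ.≤ α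
  cap≤α ⊤⁺    = ℚ.≤-refl
  cap≤α [ x ] = ℚ.p⊓q≤p α x

  -- Every root contributes at most `α` to `∑cap`, and a root of value `β` falls short of `α` by at
  -- least `α - β`.
  ∑cap-count : ∀ {n} (rs : Vec Carrier n) {β} → β ℚ.≤ α →
    Vec.count (λ r → ≡-dec ℚ._≟_ (v r) [ β ]) rs ℚ× (α ℚ.- β) ℚ.+ ∑cap rs ℚ.≤ n ℚ× α
  ∑cap-count Vec.[]                   β≤α = ℚ.≤-refl
  ∑cap-count {suc n} (r Vec.∷ rs) {β} β≤α with ≡-dec ℚ._≟_ (v r) [ β ]
  ... | no  _    = begin
    m ℚ.+ (cap (v r) ℚ.+ S)            ≡⟨ solve 3 (λ m c S → m :+ (c :+ S) := c :+ (m :+ S)) ≡.refl m (cap (v r)) S ⟩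
    cap (v r) ℚ.+ (m ℚ.+ S)            ≤⟨ ℚ.+-mono-≤ (cap≤α (v r)) (∑cap-count rs β≤α) ⟩
    suc n ℚ× α                         ∎
    where
    open ℚ.≤-Reasoning
    S = ∑cap rs
    m = Vec.count (λ r → ≡-dec ℚ._≟_ (v r) [ β ]) rs ℚ× (α ℚ.- β)
  ... | yes vr≡β rewrite vr≡β = begin
    (δ ℚ.+ m) ℚ.+ (α ℚ.⊓ β ℚ.+ S)      ≤⟨ ℚ.+-monoʳ-≤ (δ ℚ.+ m) (ℚ.+-monoˡ-≤ S (ℚ.p⊓q≤q α β)) ⟩
    (δ ℚ.+ m) ℚ.+ (β ℚ.+ S)            ≡⟨ rearrange α β m S ⟩
    α ℚ.+ (m ℚ.+ S)                    ≤⟨ ℚ.+-monoʳ-≤ α (∑cap-count rs β≤α) ⟩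
    suc n ℚ× α                         ∎
    where
    open ℚ.≤-Reasoning
    S = ∑cap rs
    δ = α ℚ.- β
    m = Vec.count (λ r → ≡-dec ℚ._≟_ (v r) [ β ]) rs ℚ× δ

    rearrange : ∀ α β m S → ((α ℚ.- β) ℚ.+ m) ℚ.+ (β ℚ.+ S) ≡ α ℚ.+ (m ℚ.+ S)
    rearrange = solve 4 (λ α β m S → ((α :- β) :+ m) :+ (β :+ S) := α :+ (m :+ S)) ≡.refl

-- Embedding `𝔽_q[t]` in both towers and comparing characteristic polynomials.

valuedFieldHom-injective : {K L : ValuedField c ℓ} (h : ValuedFieldHom K L) →
  let open ValuedFieldHom h
      module K = ValuedField K
      module L = ValuedField L in
  ∀ {x y} → ⟦ x ⟧ L.≈ ⟦ y ⟧ → x K.≈ y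
valuedFieldHom-injective {K = K} {L} h {x} {y} fx≈fy =
  x∙y⁻¹≈ε⇒x≈y x y (K.v-⊤ (x K.- y) (≡.trans (≡.sym (v-preserved (x K.- y)))
    (≡.trans (L.v-cong f[x-y]≈0) L.v-0)))
  where
  module K = ValuedField K
  module L = ValuedField L
  open ValuedFieldHom h
  open IsRingHomomorphism isHomomorphism
  open RingProperties K.ring using (x∙y⁻¹≈ε⇒x≈y)

  f[x-y]≈0 : ⟦ x K.- y ⟧ L.≈ L.0#
  f[x-y]≈0 = L.trans (+-homo x (K.- y)) (L.trans (L.+-cong fx≈fy (-‿homo y)) (L.-‿inverseʳ _))

module _ {k : Field c ℓ} (_≟_ : Decidable (Field._≈_ k)) {e : ℚ}
         (k[t] : RationalFunctionField k e) where
  private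
    module k = Field k
  open RationalFunctionField k[t]
  open ValuedField valuedField hiding (zero; sum)
  open FieldHom constants
  open IsRingHomomorphism isHomomorphism
  open Valuation valuedField
  open Evaluation constants t
  open RingProperties ring using (xyx⁻¹≈y)

  private
    ev : List k.Carrier → Carrier
    ev = evalAt t

  -- `v-constants` covers non-zero constants, whence the case split; zero has value `⊤⁺`.
  constants≽0 : ∀ a → ⟦ a ⟧ ≽ 0ℚ
  constants≽0 a with a ≟ k.0#
  ... | yes a≈0 = ≽-cong (sym (trans (⟦⟧-cong a≈0) 0#-homo)) (0≽ 0ℚ)
  ... | no  a≉0 = ≡⇒≽ (v-constants a a≉0)

  -- When v t < 0 the leading term of a non-zero polynomial dominates.
  evalAt-v≤0 : e ℚ.< 0ℚ → ∀ p → (∀ i → k.coeff p i k.≈ k.0#) ⊎ (v (ev p) ≤⁺ [ 0ℚ ])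
  evalAt-v≤0 e<0 [] = inj₁ λ i → k.refl
  evalAt-v≤0 e<0 (a ∷ p) with evalAt-v≤0 e<0 p
  ... | inj₂ vp≤0 with ≤⁺-dec ℚ._≤?_ (v (ev (a ∷ p))) [ 0ℚ ]
  ...   | yes v≤0 = inj₂ v≤0
  -- Otherwise `t * ev p`, being the whole value minus the constant `⟦ a ⟧`, would have valuation at
  -- least 0, whereas it is `e` plus something at most 0.
  ...   | no  v≰0 = ⊥-elim (v[t*p]<0 (v (ev p)) vp≤0
            (subst ([ 0ℚ ] ≤⁺_) (≡.trans (v-* t (ev p)) (cong (_+⁺ v (ev p)) v-t)) t*p≽0))
    where
    t*p≽0 : t * ev p ≽ 0ℚ
    t*p≽0 = ≽-cong (xyx⁻¹≈y ⟦ a ⟧ (t * ev p)) (≽-+ (≻⇒≽ v≰0) (≽-neg (constants≽0 a)))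

    v[t*p]<0 : ∀ w → w ≤⁺ [ 0ℚ ] → ¬ [ 0ℚ ] ≤⁺ [ e ] +⁺ w
    v[t*p]<0 [ w ] [ w≤0 ] [ 0≤e+w ] =
      ℚ.<-irrefl ≡.refl (ℚ.≤-<-trans 0≤e+w (ℚ.+-mono-<-≤ e<0 w≤0))
  evalAt-v≤0 e<0 (a ∷ p) | inj₁ p≈0 with a ≟ k.0#
  ... | yes a≈0 = inj₁ λ { zero → a≈0 ; (suc i) → p≈0 i }
  ... | no  a≉0 = inj₂ (subst (_≤⁺ [ 0ℚ ]) (≡.trans (≡.sym (v-constants a a≉0)) (v-cong (sym p≈a)))
                         [ ℚ.≤-refl ])
    where
    p≈a : ev (a ∷ p) ≈ ⟦ a ⟧
    p≈a = trans (+-congˡ (trans (*-congˡ (evalAt-0 p p≈0)) (zeroʳ t))) (+-identityʳ _)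

  -- The dichotomy `evalAt-v≤0` is applied to the difference of `p` and `r`: it evaluates to 0, of
  -- value `⊤⁺`, so its coefficients must vanish.
  evalAt-injective : e ℚ.< 0ℚ → ∀ p r → ev p ≈ ev r → ∀ i → k.coeff p i k.≈ k.coeff r i
  evalAt-injective e<0 p r p≈r i with evalAt-v≤0 e<0 (k.addᴾ p (List.map k.-_ r))
  ... | inj₁ p-r≈0 = RingProperties.x∙y⁻¹≈ε⇒x≈y k.ring _ _
        (k.trans (k.sym (k.trans (coeff-addᴾ p (List.map k.-_ r) i) (k.+-congˡ (coeff-negᴾ r i)))) (p-r≈0 i))
    where open Coefficients k.commutativeRing
  ... | inj₂ v≤0 = ⊥-elim (0≻ 0ℚ (subst (_≤⁺ [ 0ℚ ]) (v-cong p-r≈0) v≤0))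
    where
    p-r≈0 : ev (k.addᴾ p (List.map k.-_ r)) ≈ 0#
    p-r≈0 = trans (evalAt-+ p (List.map k.-_ r))
      (trans (+-cong p≈r (evalAt-neg r)) (-‿inverseʳ _))

module _ {k : Field c ℓ} {e : ℚ} (τ : LocalTower k e) where
  open LocalTower τ
  private
    module k = Field k

  k[t]→K̄-isRingHomomorphism :
    IsRingHomomorphism k.polynomialRing (ValuedField.rawRing K̄.valuedField) k[t]→K̄
  k[t]→K̄-isRingHomomorphism =
    Compose.isRingHomomorphism (ValuedField.trans K̄.valuedField)
      (Compose.isRingHomomorphism (ValuedField.trans K.valuedField)
        (Evaluation.evalAt-isRingHomomorphism F.constants F.t)
        (ValuedFieldHom.isHomomorphism K.embedding))
      (ValuedFieldHom.isHomomorphism K̄.embedding)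

  v-F→K̄ : ∀ x → ValuedField.v K̄.valuedField (F→K̄ x) ≡ ValuedField.v F.valuedField x
  v-F→K̄ x = ≡.trans (ValuedFieldHom.v-preserved K̄.embedding _) (ValuedFieldHom.v-preserved K.embedding x)

  k[t]→K̄-injective : Decidable k._≈_ → e ℚ.< 0ℚ → ∀ p r →
    ValuedField._≈_ K̄.valuedField (k[t]→K̄ p) (k[t]→K̄ r) → ∀ i → k.coeff p i k.≈ k.coeff r i
  k[t]→K̄-injective _≟_ e<0 p r p≈r = evalAt-injective _≟_ rationalFunctions e<0 p r
    (valuedFieldHom-injective K.embedding (valuedFieldHom-injective K̄.embedding p≈r))

module _ {q : ℕ} (𝔽q : FiniteField c ℓ q) where
  private module 𝔽q = FiniteField 𝔽q

  finiteField-≟ : Decidable 𝔽q._≈_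
  finiteField-≟ = via-injection (Inverse⇒Injection (inverse 𝔽q.enumeration)) Fin._≟_

  module _ (∞ : TowerAtInfinity 𝔽q.field′) where
    private module ∞ = TowerAtInfinity ∞
    open Drinfeld 𝔽q ∞
    open ValuedField ∞.C∞.valuedField using (_≈_; rawRing; trans)

    ⟦⟧-isRingHomomorphism : IsRingHomomorphism 𝔽q.polynomialRing rawRing ⟦_⟧
    ⟦⟧-isRingHomomorphism =
      Compose.isRingHomomorphism trans (k[t]→K̄-isRingHomomorphism ∞.localTower)
        (ValuedFieldHom.isHomomorphism ∞.C∞.embedding)

    ⟦⟧-injective : ∀ p r → ⟦ p ⟧ ≈ ⟦ r ⟧ → ∀ i → 𝔽q.coeff p i 𝔽q.≈ 𝔽q.coeff r i
    ⟦⟧-injective p r p≈r = k[t]→K̄-injective ∞.localTower finiteField-≟ (ℚ.*<* ℤ.-<+) p r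
      (valuedFieldHom-injective ∞.C∞.embedding p≈r)

-- No map between `S` and `S′` is involved. By parametricity each coefficient of either side comes
-- from one in `R`; injectivity of `f` pulls the identity back to `R`, and `g` pushes it forward.
charPoly-transport : {R : RawRing a ℓ₁} {S : CommutativeRing b ℓ₂} {S′ : CommutativeRing b ℓ₂} →
  let module R = RawRing R
      module S = CommutativeRing S
      module S′ = CommutativeRing S′ in
  ∀ {f : R.Carrier → S.Carrier} {g : R.Carrier → S′.Carrier} →
  IsRingHomomorphism R S.rawRing f → IsRingHomomorphism R S′.rawRing g →
  (∀ x y → f x S.≈ f y → x R.≈ y) →
  ∀ {n} (P : Vec R.Carrier n) (A : Matrix R.Carrier n) →
  RawRing._≈_ (Polynomial.polynomialRing S.rawRing)
    (Polynomial.monic S.rawRing (Vec.map f P)) (charPoly S.rawRing λ a b → f (A a b)) →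
  RawRing._≈_ (Polynomial.polynomialRing S′.rawRing)
    (Polynomial.monic S′.rawRing (Vec.map g P)) (charPoly S′.rawRing λ a b → g (A a b))
charPoly-transport {R = R} {S} {S′} {f} {g} f-hom g-hom f-injective P A P≈A i =
  S′.trans (S′.sym (coeff-resp g-graph (monic-resp g-graph P g λ _ → S′.refl) i))
    (S′.trans (IsRingHomomorphism.⟦⟧-cong g-hom P≈A-in-R)
      (coeff-resp g-graph (charPoly-resp g-graph A _ λ _ _ → S′.refl) i))
  where
  module R = RawRing R
  module S = CommutativeRing S
  module S′ = CommutativeRing S′
  module R[X] = Polynomial R
  f-graph = graph-isRingRelation S f-hom
  g-graph = graph-isRingRelation S′ g-hom

  P≈A-in-R : R[X].coeff (R[X].monic P) i R.≈ R[X].coeff (charPoly R A) i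
  P≈A-in-R = f-injective _ _
    (S.trans (coeff-resp f-graph (monic-resp f-graph P f λ _ → S.refl) i)
      (S.trans (P≈A i) (S.sym (coeff-resp f-graph (charPoly-resp f-graph A _ λ _ _ → S.refl) i))))

-- Multiples in ℚ, column bounds for `MD`, and the slopes.

ℚ×1≡/1 : ∀ m → m ℚ× 1ℚ ≡ + m ℚ./ 1
ℚ×1≡/1 zero    = ≡.refl
-- Since `/` normalises fractions, the addition is checked on unnormalised rationals, where it
-- reduces to integer arithmetic.
ℚ×1≡/1 (suc m) = ≡.trans (cong (1ℚ ℚ.+_) (ℚ×1≡/1 m)) (ℚ.toℚᵘ-injective (begin-equality
  ℚ.toℚᵘ (1ℚ ℚ.+ (+ m ℚ./ 1))              ≃⟨ ℚ.toℚᵘ-homo-+ 1ℚ (+ m ℚ./ 1) ⟩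
  ℚ.toℚᵘ 1ℚ ℚᵘ.+ ℚ.toℚᵘ (+ m ℚ./ 1)        ≃⟨ ℚᵘ.+-congʳ (ℚ.toℚᵘ 1ℚ) (ℚ.toℚᵘ-fromℚᵘ (mkℚᵘ (+ m) 0)) ⟩
  ℚ.toℚᵘ 1ℚ ℚᵘ.+ mkℚᵘ (+ m) 0              ≃⟨ *≡* (cong (λ i → (+ 1 ℤ.+ i) ℤ.* + 1) (ℤ.*-identityʳ (+ m))) ⟩
  mkℚᵘ (+ suc m) 0                         ≃⟨ ℚ.toℚᵘ-fromℚᵘ (mkℚᵘ (+ suc m) 0) ⟨
  ℚ.toℚᵘ (+ suc m ℚ./ 1)                   ∎))
  where open ℚᵘ.≤-Reasoning

ℚ×-monoˡ-≤ : ∀ {x m n} → 0ℚ ℚ.≤ x → m ℕ.≤ n → m ℚ× x ℚ.≤ n ℚ× x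
ℚ×-monoˡ-≤ {n = zero}  0≤x z≤n = ℚ.≤-refl
ℚ×-monoˡ-≤ {n = suc n} 0≤x z≤n = ℚ.+-mono-≤ 0≤x (ℚ×-monoˡ-≤ {n = n} 0≤x z≤n)
ℚ×-monoˡ-≤ {x} 0≤x (s≤s m≤n)  = ℚ.+-monoʳ-≤ x (ℚ×-monoˡ-≤ 0≤x m≤n)

module _ {q : ℕ} (1<q : 1 ℕ.< q) (𝔽q : FiniteField c ℓ q) (τ : Tower-t (FiniteField.field′ 𝔽q)) (j : ℕ) where
  private
    module 𝔽q = FiniteField 𝔽q
    module 𝔽q[t] = RawRing 𝔽q.polynomialRing
    module τ = LocalTower τ
  open ValuedField τ.K̄.valuedField hiding (zero; sum)
  open Valuation τ.K̄.valuedField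

  private
    open RawSemiringDefs 𝔽q[t].rawSemiring using () renaming (_^_ to _^ᴾ_)
    module Eval = Evaluation τ.F.constants τ.F.t
    module F where
      open ValuedField τ.F.valuedField public
      open Valuation τ.F.valuedField public

    -- These are j + 2 and j + 1. As iterated sums, `α` is definitionally `suc (suc j) ℚ× 1ℚ`, so
    -- comparisons with the exponents `s` reduce to natural numbers.
    α β : ℚ
    β = suc j ℚ× 1ℚ
    α = 1ℚ ℚ.+ β

    columnBound : ∀ {n} → Fin n → ℚ
    columnBound zero    = β
    columnBound (suc b) = α

    0≤1 : 0ℚ ℚ.≤ 1ℚ
    0≤1 = ℚ.*≤* (ℤ.+≤+ z≤n)

    β≤α : β ℚ.≤ α
    β≤α = ℚ×-monoˡ-≤ 0≤1 (ℕ.n≤1+n (suc j))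

    columnBound≤α : ∀ {n} (b : Fin n) → columnBound b ℚ.≤ α
    columnBound≤α zero    = β≤α
    columnBound≤α (suc b) = ℚ.≤-refl

    columnBound≤s : ∀ {n} (b : Fin n) → columnBound b ℚ.≤ Explicit.s 𝔽q j n b ℚ× 1ℚ
    columnBound≤s {n} zero    = ℚ×-monoˡ-≤ 0≤1 (ℕ.≤-trans (ℕ.≤-reflexive (ℕ.+-comm 1 j)) (ℕ.m≤m+n (j ℕ.+ 1) 0))
    columnBound≤s {n} (suc b) = ℚ×-monoˡ-≤ {m = suc (suc j)} 0≤1 (begin
      suc (suc j)                        ≡⟨ cong suc (ℕ.+-comm 1 j) ⟩
      suc (j ℕ.+ 1)                      ≡⟨ ℕ.+-comm 1 (j ℕ.+ 1) ⟩
      -- From `1 < q` the step `q ∸ 1` between successive exponents is at least 1.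
      j ℕ.+ 1 ℕ.+ 1                      ≤⟨ ℕ.+-monoʳ-≤ (j ℕ.+ 1) (ℕ.∸-monoˡ-≤ 1 1<q) ⟩
      j ℕ.+ 1 ℕ.+ (q ℕ.∸ 1)              ≤⟨ ℕ.+-monoʳ-≤ (j ℕ.+ 1) (ℕ.m≤m+n (q ℕ.∸ 1) _) ⟩
      Explicit.s 𝔽q j n (suc b)          ∎)
      where open ℕ.≤-Reasoning

    -- The estimate is made in `𝔽_q(t)`, whose valuation both embeddings preserve. Equality fails
    -- when `a` is zero.
    constant*power≽ : ∀ a s → τ.k[t]→K̄ (𝔽q.const a 𝔽q[t].* 𝔽q.indeterminate ^ᴾ s) ≽ s ℚ× 1ℚ
    constant*power≽ a s = subst ([ s ℚ× 1ℚ ] ≤⁺_) (≡.sym (v-F→K̄ τ _))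
      (F.≽-cong (F.sym evaluated)
        (subst (⟦a⟧*t^s F.≽_) (ℚ.+-identityˡ (s ℚ× 1ℚ))
          (F.≽-* (constants≽0 (finiteField-≟ 𝔽q) τ.rationalFunctions a) (F.≽-^ (F.≡⇒≽ τ.F.v-t) s))))
      where
      ⟦a⟧*t^s = FieldHom.⟦_⟧ τ.F.constants a F.* τ.F.t F.^ s
      t-graph = graph-isRingRelation F.commutativeRing Eval.evalAt-isRingHomomorphism

      evaluated : FieldHom.evalAt τ.F.constants τ.F.t (𝔽q.const a 𝔽q[t].* 𝔽q.indeterminate ^ᴾ s) F.≈ ⟦a⟧*t^s
      evaluated = IsRingRelation.*-resp t-graph {𝔽q.const a} {_} {𝔽q.indeterminate ^ᴾ s}
        (Eval.evalAt-const a) (^-resp t-graph {𝔽q.indeterminate} Eval.evalAt-indeterminate s)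

    MD≽columnBound : ∀ {n} (a b : Fin n) → τ.k[t]→K̄ (Explicit.MD 𝔽q j n a b) ≽ columnBound b
    MD≽columnBound {n} a b =
      ≽-weaken (columnBound≤s b) (constant*power≽ (Explicit.M 𝔽q j n a b) (Explicit.s 𝔽q j n b))

    ∑columnBound : ∀ n → ∑ (columnBound {suc n}) ≡ β ℚ.+ n ℚ× α
    ∑columnBound n = cong (β ℚ.+_) (sum-replicate n)

  module _ {n : ℕ} (P : Vec (List 𝔽q.Carrier) (suc n))
           (P≈χ : RawRing._≈_ polynomialRing (monic (Vec.map τ.k[t]→K̄ P))
                    (charPoly rawRing λ a b → τ.k[t]→K̄ (Explicit.MD 𝔽q j (suc n) a b))) where
    open Slopes τ P
    open GaussValuation τ.K̄.valuedField α

    -- The total deficit available to the roots is `suc n` times `α` minus the column sum `β + n α`,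
    -- which is exactly 1; each root of value `γ` uses up `α - γ` of it.
    multiplicity-bound : ∀ {γ} → γ ℚ.≤ α → multiplicity γ ℚ× (α ℚ.- γ) ℚ.≤ 1ℚ
    multiplicity-bound {γ} γ≤α = begin
      m                                  ≡⟨ solve 2 (λ m S → m := (m :+ S) :- S) ≡.refl m S ⟩
      (m ℚ.+ S) ℚ.- S                    ≤⟨ ℚ.+-mono-≤ (∑cap-count roots γ≤α) (ℚ.neg-antimono-≤ ∑≤∑cap) ⟩
      suc n ℚ× α ℚ.- (β ℚ.+ n ℚ× α)      ≡⟨ rearrange 1ℚ β (n ℚ× α) ⟩
      1ℚ                                 ∎
      where
      open ℚ.≤-Reasoning
      S = ∑cap roots
      m = multiplicity γ ℚ× (α ℚ.- γ)

      rearrange : ∀ u β x → ((u ℚ.+ β) ℚ.+ x) ℚ.- (β ℚ.+ x) ≡ u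
      rearrange = solve 3 (λ u β x → ((u :+ β) :+ x) :- (β :+ x) := u) ≡.refl

      χ = charPoly rawRing λ a b → τ.k[t]→K̄ (Explicit.MD 𝔽q j (suc n) a b)

      ∏≈χ : ∀ i → coeff ∏[X- roots ] i ≈ coeff χ i
      ∏≈χ i = trans (sym (proj₂ (τ.K̄.splits (Vec.map τ.k[t]→K̄ P)) i)) (P≈χ i)

      ∏≥ : Gauss≥ (∑ (columnBound {suc n})) ∏[X- roots ]
      ∏≥ = gauss≥ λ i → ≽-cong (sym (∏≈χ i))
        (coeff≽ (gauss-charPoly (λ a b → τ.k[t]→K̄ (Explicit.MD 𝔽q j (suc n) a b))
          columnBound columnBound≤α MD≽columnBound) i)

      ∑≤∑cap : β ℚ.+ n ℚ× α ℚ.≤ ∑cap roots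
      ∑≤∑cap = subst (ℚ._≤ ∑cap roots) (∑columnBound n) (gauss≥⇒≤∑cap roots ∏≥)

    -- Below `α`, a single root of value `γ` already forces `α - γ ≤ 1`, and `α - 1` is `β`.
    slope≥β : ∀ γ → IsSlope γ → β ℚ.≤ γ
    slope≥β γ γ-slope with γ ℚ.≤? α
    ... | no  γ≰α = ℚ.≤-trans β≤α (ℚ.<⇒≤ (ℚ.≰⇒> γ≰α))
    ... | yes γ≤α = begin
      β                            ≡⟨ solve 3 (λ u β γ → β := ((u :+ β) :- γ) :+ (γ :- u)) ≡.refl 1ℚ β γ ⟩
      (α ℚ.- γ) ℚ.+ (γ ℚ.- 1ℚ)     ≤⟨ ℚ.+-monoˡ-≤ (γ ℚ.- 1ℚ) α-γ≤1 ⟩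
      1ℚ ℚ.+ (γ ℚ.- 1ℚ)            ≡⟨ solve 2 (λ u γ → u :+ (γ :- u) := γ) ≡.refl 1ℚ γ ⟩
      γ                            ∎
      where
      open ℚ.≤-Reasoning
      0≤α-γ : 0ℚ ℚ.≤ α ℚ.- γ
      0≤α-γ = subst (ℚ._≤ α ℚ.- γ) (ℚ.+-inverseʳ γ) (ℚ.+-monoˡ-≤ (ℚ.- γ) γ≤α)
      α-γ≤1 : α ℚ.- γ ℚ.≤ 1ℚ
      α-γ≤1 = begin
        α ℚ.- γ                     ≡⟨ ℚ.+-identityʳ _ ⟨
        1 ℚ× (α ℚ.- γ)              ≤⟨ ℚ×-monoˡ-≤ 0≤α-γ γ-slope ⟩
        multiplicity γ ℚ× (α ℚ.- γ) ≤⟨ multiplicity-bound γ≤α ⟩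
        1ℚ                          ∎

    -- A root of value `β` uses up the whole deficit 1, so two of them would give 2 ≤ 1.
    multiplicity-β≤1 : multiplicity β ℕ.≤ 1
    multiplicity-β≤1 = ℕ.≮⇒≥ λ 2≤m → 2≰1 (ℚ.≤-trans (ℚ×-monoˡ-≤ 0≤1 2≤m)
      (subst (λ x → multiplicity β ℚ× x ℚ.≤ 1ℚ) α-β≡1 (multiplicity-bound β≤α)))
      where
      α-β≡1 : α ℚ.- β ≡ 1ℚ
      α-β≡1 = solve 2 (λ u β → (u :+ β) :- β := u) ≡.refl 1ℚ β

      2≰1 : ¬ 2 ℚ× 1ℚ ℚ.≤ 1ℚ
      2≰1 (ℚ.*≤* (ℤ.+≤+ (s≤s ())))

-- From the matrix of the Atkin operator over C_∞ to its slopes.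

open import Data.Nat.Base using (_+_; _*_; _∸_; _^_; _≤_)

proposition6p2 : ∀ {c ℓ} (p r q : ℕ) → Prime p → 1 ≤ r → q ≡ p ^ r →
    (𝔽q : FiniteField c ℓ q)
    (∞ : TowerAtInfinity (FiniteField.field′ 𝔽q))
    (τ : Tower-t (FiniteField.field′ 𝔽q))
    (j n : ℕ) → j ≤ q ∸ 2 → 1 ≤ n →
    (k m : ℤ) → k ≡ + (2 * j + 2 + (n ∸ 1) * (q ∸ 1)) →
    (+ (q ∸ 1)) ∣ℤ (m ℤ.- + (j + 1)) →
    let open Drinfeld 𝔽q ∞ in
    (∃[ e ] IsBasis k m {n} e × IsMatrixOfU e (λ a b → ⟦ Explicit.MD 𝔽q j n a b ⟧)) →
    (P : Vec (List (FiniteField.Carrier 𝔽q)) n) → IsCharPolyOfU k m P →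
    let open Slopes τ P in
    (∀ α → IsSlope α → (+ (j + 1) ℚ./ 1) ℚ.≤ α) × multiplicity (+ (j + 1) ℚ./ 1) ≤ 1
proposition6p2 p r q p-prime 1≤r q≡p^r 𝔽q ∞ τ j (suc n) _ _ k m _ _
               (e , e-basis , e-matrix) P χ-is-P =
  -- The bounds were obtained for the iterated sum `suc j ℚ× 1ℚ`, which is rewritten as the fraction
  -- `+ (j + 1) / 1`.
  subst (λ β → (∀ α → IsSlope α → β ℚ.≤ α) × multiplicity β ≤ 1)
    (≡.trans (ℚ×1≡/1 (suc j)) (cong (λ i → + i ℚ./ 1) (ℕ.+-comm 1 j)))
    (slope≥β 1<q 𝔽q τ j P P≈χ , multiplicity-β≤1 1<q 𝔽q τ j P P≈χ)
  where
  open Drinfeld 𝔽q ∞ using (⟦_⟧)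
  open Slopes τ P

  1<q : 1 ℕ.< q
  1<q = subst (1 ℕ.<_) (≡.sym q≡p^r) (ℕ.^-monoʳ-< p 1<p 1≤r)
    where
    1<p : 1 ℕ.< p
    1<p = ℕ.nonTrivial⇒n>1 p {{prime⇒nonTrivial p-prime}}

  -- In the given basis `χ-is-P` identifies `P` with the characteristic polynomial of `MD` over C_∞;
  -- the identity passes through `𝔽_q[t]` to the closure of `𝔽_q((t))`.
  P≈χ = charPoly-transport
    {R = Field.polynomialRing (FiniteField.field′ 𝔽q)}
    {S = ValuedField.commutativeRing (TowerAtInfinity.C∞.valuedField ∞)}
    {S′ = ValuedField.commutativeRing (LocalTower.K̄.valuedField τ)}
    (⟦⟧-isRingHomomorphism 𝔽q ∞) (k[t]→K̄-isRingHomomorphism τ) (⟦⟧-injective 𝔽q ∞)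
    P (Explicit.MD 𝔽q j (suc n)) (χ-is-P e (λ a b → ⟦ Explicit.MD 𝔽q j (suc n) a b ⟧) e-basis e-matrix)
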